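{- For any $n \in \mathbb{N}$, the weak order $\preccurlyeq$ restricted to the set of all posets (partial orders) on $[n] = \{1, \dots, n\}$ is a lattice.
   Context: A poset on $[n]$ is a reflexive, transitive, antisymmetric binary relation $R \subseteq [n]^2$. For a reflexive binary relation $R \subseteq [n]^2$, let $R^{\mathsf{Inc}} = \{(a,b) \in R : a \le b\}$ and $R^{\mathsf{Dec}} = \{(b,a) \in R : a \le b\}$, where $\le$ is the natural order on integers. The weak order on reflexive binary relations on $[n]$ is defined by $R \preccurlyeq S$ if and only if $R^{\mathsf{Inc}} \supseteq S^{\mathsf{Inc}}$ and $R^{\mathsf{Dec}} \subseteq S^{\mathsf{Dec}}$. -}

module Defs where

open import Data.Fin.Base using (Fin; _≤_)
open import Data.Nat.Base using (ℕ)
open import Data.Product.Base using (_×_)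
open import Function.Base using (_on_)
open import Level using (0ℓ; suc)
open import Relation.Binary.Core using (Rel; _⇒_; _⇔_)
open import Relation.Binary.Definitions using (Reflexive; Decidable)
open import Relation.Binary.PropositionalEquality.Core using (_≡_)
open import Relation.Binary.Structures using (IsDecPartialOrder)

-- [n] is represented by Fin n, via the order isomorphism i ↦ 1 + toℕ i.
-- A subset of the finite set [n]² is represented by a decidable relation on
-- Fin n, two such being identified when they hold of the same pairs.

record ReflexiveRelation (n : ℕ) : Set (suc 0ℓ) where
  field
    rel       : Rel (Fin n) 0ℓ
    reflexive : Reflexive rel
    decidable : Decidable rel

open ReflexiveRelation using (rel)

record PosetOn (n : ℕ) : Set (suc 0ℓ) where
  field
    _⊑_               : Rel (Fin n) 0ℓ
    isDecPartialOrder : IsDecPartialOrder _≡_ _⊑_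

  open IsDecPartialOrder isDecPartialOrder public
    using (refl; trans; antisym) renaming (_≤?_ to _⊑?_)

  toReflexiveRelation : ReflexiveRelation n
  toReflexiveRelation = record
    { rel       = _⊑_
    ; reflexive = refl
    ; decidable = _⊑?_
    }

open PosetOn public using (toReflexiveRelation)

module _ {n : ℕ} where

  IncPart : ReflexiveRelation n → Rel (Fin n) 0ℓ
  IncPart R a b = rel R a b × a ≤ b

  DecPart : ReflexiveRelation n → Rel (Fin n) 0ℓ
  DecPart R b a = rel R b a × a ≤ b

  infix 4 _≼_ _≈_ _≼ₚ_ _≈ₚ_

  _≼_ : Rel (ReflexiveRelation n) 0ℓ
  R ≼ S = (IncPart S ⇒ IncPart R) × (DecPart R ⇒ DecPart S)

  _≈_ : Rel (ReflexiveRelation n) 0ℓ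
  R ≈ S = rel R ⇔ rel S

  _≼ₚ_ : Rel (PosetOn n) 0ℓ
  _≼ₚ_ = _≼_ on toReflexiveRelation

  _≈ₚ_ : Rel (PosetOn n) 0ℓ
  _≈ₚ_ = _≈_ on toReflexiveRelation

{-# OPTIONS --safe #-}

-- Write I for the transitive closure of R^Inc ∪ S^Inc and D for R^Dec ∩ S^Dec.
-- The meet of R and S keeps I, and keeps a pair (b , a) of D exactly when every
-- path  i I b D a I j  closes up to a pair (i , j) of I ∪ D.  Deleting the other
-- pairs makes I ∪ D transitive, and also antisymmetric: if x I y D x, the first
-- edge x → k leaves a path  k I y D x  that closes up to (k , x); as x < k this lies
-- in both R and S, while (x , k) lies in one of them.  If P is a poset below R
-- and S and (b , a) is a decreasing pair of P, then walking along the paths i I b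
-- and a I j with P, R, S all transitive shows that the path closes up.
-- Joins are meets of the opposite posets.

module Submission where

open import Data.Nat.Base using (ℕ)
open import Data.Product.Base using (∃₂)
open import Algebra.Core using (Op₂)
open import Relation.Binary.Lattice.Structures using (IsLattice)
open import Defs

open import Data.Fin.Base using (Fin; _≤_; _<_)
open import Data.Fin.Induction using (Acc; acc; >-wellFounded)
open import Data.Fin.Properties using (_≟_; _≤?_; _<?_; ≤-refl; ≤-trans; ≤-antisym; ≤-total; ≤∧≢⇒<; <⇒≢; any?; all?)
open import Data.Nat.Properties using (<⇒≤; <⇒≱)
open import Data.Product.Base using (_×_; _,_; proj₁; proj₂; ∃; swap)
open import Data.Sum.Base using (_⊎_; inj₁; inj₂; [_,_]′)
open import Function.Base using (_∘_; id; flip)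
open import Level using (0ℓ)
open import Relation.Binary.Construct.Closure.ReflexiveTransitive using (Star; ε; _◅_; _◅◅_)
import Relation.Binary.Construct.Flip.EqAndOrd as Flip
open import Relation.Binary.Core using (Rel; _⇒_)
open import Relation.Binary.Definitions using (Transitive; Antisymmetric; Decidable)
open import Relation.Binary.Lattice.Definitions using (Infimum; Supremum)
open import Relation.Binary.PropositionalEquality using (_≡_; refl; sym; isEquivalence)
open import Relation.Binary.Structures using (IsPartialOrder; IsDecPartialOrder)
open import Relation.Nullary using (Dec; yes; no; contradiction)
open import Relation.Nullary.Decidable using (_×-dec_; _⊎-dec_; _→-dec_; map′)

open PosetOn using (_⊑_; _⊑?_)

module _ {n : ℕ} {E : Rel (Fin n) 0ℓ} (E⇒< : E ⇒ _<_) where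

  Star-increasing : Star E ⇒ _≤_
  Star-increasing ε        = ≤-refl
  Star-increasing (e ◅ es) = ≤-trans (<⇒≤ (E⇒< e)) (Star-increasing es)

  -- Needed because a `PosetOn` carries a decision procedure. Edges go strictly up, so the search
  -- for a path, one first edge at a time, terminates by well-foundedness of `>` on `Fin n`.
  Star-decidable : Decidable E → Decidable (Star E)
  Star-decidable E? i j = go i (>-wellFounded i)
    where
    Step : Fin n → Set
    Step i = i ≡ j ⊎ ∃ λ k → E i k × Star E k j

    fromStep : ∀ {i} → Step i → Star E i j
    fromStep (inj₁ refl)         = ε
    fromStep (inj₂ (_ , e , es)) = e ◅ es

    toStep : ∀ {i} → Star E i j → Step i
    toStep ε        = inj₁ refl
    toStep (e ◅ es) = inj₂ (_ , e , es)

    go : ∀ i → Acc (flip _<_) i → Dec (Star E i j)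
    go i (acc rs) = map′ fromStep toStep ((i ≟ j) ⊎-dec any? edge?)
      where
      edge? : ∀ k → Dec (E i k × Star E k j)
      edge? k with E? i k
      ... | yes e = map′ (e ,_) proj₂ (go k (rs (E⇒< e)))
      ... | no ¬e = no (¬e ∘ proj₁)

module Meet {n : ℕ} (R S : PosetOn n) where

  private
    module R = PosetOn R
    module S = PosetOn S

  -- Strictness makes paths climb, as the search above requires; the diagonal comes back as `ε`.
  Edge : Rel (Fin n) 0ℓ
  Edge a b = (a R.⊑ b ⊎ a S.⊑ b) × a < b

  Edge⇒< : Edge ⇒ _<_
  Edge⇒< = proj₂

  I : Rel (Fin n) 0ℓ
  I = Star Edge

  I-increasing : I ⇒ _≤_
  I-increasing = Star-increasing Edge⇒<

  inc⇒I : ∀ {a b} → a R.⊑ b ⊎ a S.⊑ b → a ≤ b → I a b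
  inc⇒I {a} {b} r a≤b with a ≟ b
  ... | yes refl = ε
  ... | no  a≢b  = (r , ≤∧≢⇒< a≤b a≢b) ◅ ε

  D : Rel (Fin n) 0ℓ
  D b a = (b R.⊑ a × b S.⊑ a) × a ≤ b

  D-trans : Transitive D
  D-trans ((r , s) , y≤x) ((r′ , s′) , z≤y) =
    (R.trans r r′ , S.trans s s′) , ≤-trans z≤y y≤x

  I∪D : Rel (Fin n) 0ℓ
  I∪D i j = I i j ⊎ D i j

  Closes : Rel (Fin n) 0ℓ
  Closes b a = ∀ i j → I i b → I a j → I∪D i j

  infix 4 _⊓_
  _⊓_ : Rel (Fin n) 0ℓ
  x ⊓ y = I x y ⊎ (D x y × Closes x y)

  I? : Decidable I
  I? = Star-decidable Edge⇒< λ a b → (a R.⊑? b ⊎-dec a S.⊑? b) ×-dec (a <? b)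

  D? : Decidable D
  D? b a = (b R.⊑? a ×-dec b S.⊑? a) ×-dec (a ≤? b)

  ⊓-decidable : Decidable _⊓_
  ⊓-decidable x y = I? x y ⊎-dec (D? x y ×-dec
    all? λ i → all? λ j → I? i x →-dec (I? y j →-dec (I? i j ⊎-dec D? i j)))

  -- Cut at `y`: `c` classifies `(i , y)` and `c′` classifies `(y , j)`. If one of them is in `I`,
  -- it is itself an outer path for the other closing hypothesis; if both are in `D`, they compose.
  Closes-compose : ∀ {x y z} → Closes x y → Closes y z → Closes x z
  Closes-compose {y = y} c c′ i j p q with c i y p ε | c′ y j ε q
  ... | inj₁ i→y | _        = c′ i j i→y q
  ... | inj₂ _   | inj₁ y→j = c i j p y→j
  ... | inj₂ d   | inj₂ d′  = inj₂ (D-trans d d′)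

  ⊓-trans : Transitive _⊓_
  ⊓-trans (inj₁ p) (inj₁ q) = inj₁ (p ◅◅ q)
  -- A path ending at `x` extends by `p` to one ending at `y`. So `c` classifies `(x , z)` and, if
  -- that pair is in `D`, also shows that it is kept. The next case is symmetric.
  ⊓-trans {x} {y} {z} (inj₁ p) (inj₂ (_ , c)) with c x z p ε
  ... | inj₁ q = inj₁ q
  ... | inj₂ d = inj₂ (d , λ i j i→x z→j → c i j (i→x ◅◅ p) z→j)
  ⊓-trans {x} {y} {z} (inj₂ (_ , c)) (inj₁ q) with c x z ε q
  ... | inj₁ p = inj₁ p
  ... | inj₂ d = inj₂ (d , λ i j i→x z→j → c i j i→x (q ◅◅ z→j))
  ⊓-trans (inj₂ (d , c)) (inj₂ (d′ , c′)) =
    inj₂ (D-trans d d′ , Closes-compose c c′)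

  I-Closes⇒≡ : ∀ {x y} → I x y → Closes y x → x ≡ y
  I-Closes⇒≡ ε _ = refl
  I-Closes⇒≡ {x} (_◅_ {j = k} (r , x<k) k→y) c with c k x k→y ε
  ... | inj₁ k→x = contradiction (I-increasing k→x) (<⇒≱ x<k)
  ... | inj₂ ((r′ , s′) , _) =
    contradiction ([ flip R.antisym r′ , flip S.antisym s′ ]′ r) (<⇒≢ x<k)

  ⊓-antisym : Antisymmetric _≡_ _⊓_
  ⊓-antisym (inj₁ p) (inj₁ q) = ≤-antisym (I-increasing p) (I-increasing q)
  ⊓-antisym (inj₁ p) (inj₂ (_ , c)) = I-Closes⇒≡ p c
  ⊓-antisym (inj₂ (_ , c)) (inj₁ q) = sym (I-Closes⇒≡ q c)
  ⊓-antisym (inj₂ ((_ , y≤x) , _)) (inj₂ ((_ , x≤y) , _)) = ≤-antisym x≤y y≤x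

  meet : PosetOn n
  meet = record
    { _⊑_               = _⊓_
    ; isDecPartialOrder = record
      { isPartialOrder = record
        { isPreorder = record
          { isEquivalence = isEquivalence
          ; reflexive     = λ { refl → inj₁ ε }
          ; trans         = ⊓-trans
          }
        ; antisym = ⊓-antisym
        }
      ; _≟_  = _≟_
      ; _≤?_ = ⊓-decidable
      }
    }

  ⊓-dec⇒D : ∀ {b a} → b ⊓ a → a ≤ b → D b a
  ⊓-dec⇒D (inj₂ (d , _)) _ = d
  -- A pair of `I` can be weakly decreasing only on the diagonal.
  ⊓-dec⇒D (inj₁ p) a≤b with ≤-antisym a≤b (I-increasing p)
  ... | refl = (R.refl , S.refl) , a≤b

  meet≼ˡ : meet ≼ₚ R
  meet≼ˡ = (λ (r , a≤b) → inj₁ (inc⇒I (inj₁ r) a≤b) , a≤b)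
         , (λ (m , a≤b) → proj₁ (proj₁ (⊓-dec⇒D m a≤b)) , a≤b)

  meet≼ʳ : meet ≼ₚ S
  meet≼ʳ = (λ (s , a≤b) → inj₁ (inc⇒I (inj₂ s) a≤b) , a≤b)
         , (λ (m , a≤b) → proj₂ (proj₁ (⊓-dec⇒D m a≤b)) , a≤b)

  module _ (P : PosetOn n) (P≼R : P ≼ₚ R) (P≼S : P ≼ₚ S) where

    private module P = PosetOn P

    -- A lower bound contains the increasing pairs of both `R` and `S`, hence every edge, and
    -- transitivity of `P` chains the edges.
    I⇒P : I ⇒ P._⊑_
    I⇒P ε = P.refl
    I⇒P ((r , a<k) ◅ p) = P.trans
      ([ (λ r → proj₁ (proj₁ P≼R (r , <⇒≤ a<k)))
       , (λ s → proj₁ (proj₁ P≼S (s , <⇒≤ a<k))) ]′ r)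
      (I⇒P p)

    P-dec⇒D : ∀ {b a} → b P.⊑ a → a ≤ b → D b a
    P-dec⇒D p a≤b =
      (proj₁ (proj₂ P≼R (p , a≤b)) , proj₁ (proj₂ P≼S (p , a≤b))) , a≤b

    -- Walk from `a` towards `j`. While the path stays weakly below `b`, the pair remains decreasing
    -- in `P`. At the first edge reaching above `b`, the pair from `b` lies in both `R` and `S`, so
    -- it composes with that edge in whichever of them contains it, giving an increasing edge from
    -- `b`.
    P-dec-I : ∀ {b a j} → b P.⊑ a → a ≤ b → I a j → I∪D b j
    P-dec-I p a≤b ε = inj₂ (P-dec⇒D p a≤b)
    P-dec-I {b} p a≤b (_◅_ {j = k} e@(r , _) k→j) with ≤-total k b
    ... | inj₁ k≤b = P-dec-I (P.trans p (I⇒P (e ◅ ε))) k≤b k→j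
    ... | inj₂ b≤k with P-dec⇒D p a≤b
    ...   | (rba , sba) , _ = inj₁ (inc⇒I (shift r) b≤k ◅◅ k→j)
      where
      shift : _ → b R.⊑ k ⊎ b S.⊑ k
      shift = [ inj₁ ∘ R.trans rba , inj₂ ∘ S.trans sba ]′

    -- Mirror image of `P-dec-I`. Since `Star` exposes the edge farthest from `b`, the rest of the
    -- path is handled first and the edge `i` to `k` is attached afterwards.
    I-P-dec : ∀ {i b a} → I i b → b P.⊑ a → a ≤ b → I∪D i a
    I-P-dec ε p a≤b = inj₂ (P-dec⇒D p a≤b)
    I-P-dec {i} {a = a} (e@(r , _) ◅ k→b) p a≤b with I-P-dec k→b p a≤b
    ... | inj₁ k→a = inj₁ (e ◅ k→a)
    ... | inj₂ ((rka , ska) , _) with ≤-total i a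
    ...   | inj₁ i≤a = inj₁ (inc⇒I (shift r) i≤a)
      where
      shift : _ → i R.⊑ a ⊎ i S.⊑ a
      shift = [ inj₁ ∘ flip R.trans rka , inj₂ ∘ flip S.trans ska ]′
    ...   | inj₂ a≤i = inj₂ (P-dec⇒D (P.trans (I⇒P (e ◅ k→b)) p) a≤i)

    P-dec⇒Closes : ∀ {b a} → b P.⊑ a → a ≤ b → Closes b a
    P-dec⇒Closes p a≤b i j i→b a→j with I-P-dec i→b p a≤b
    ... | inj₁ i→a       = inj₁ (i→a ◅◅ a→j)
    -- The walk on the right needs a pair of `P`, not just of `D`; `(i , a)` is one because `I` is
    -- contained in `P`.
    ... | inj₂ (_ , a≤i) = P-dec-I (P.trans (I⇒P i→b) p) a≤i a→j

    meet-greatest : P ≼ₚ meet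
    meet-greatest = inc , λ (p , a≤b) → inj₂ (P-dec⇒D p a≤b , P-dec⇒Closes p a≤b) , a≤b
      where
      inc : IncPart (toReflexiveRelation meet) ⇒ IncPart (toReflexiveRelation P)
      inc (inj₁ p , a≤b) = I⇒P p , a≤b
      inc (inj₂ ((_ , b≤a) , _) , a≤b) with ≤-antisym a≤b b≤a
      ... | refl = P.refl , a≤b

open Meet using (meet; meet≼ˡ; meet≼ʳ; meet-greatest)

module _ {n : ℕ} where

  opposite : PosetOn n → PosetOn n
  opposite P = record
    { _⊑_               = flip (P ._⊑_)
    ; isDecPartialOrder = record
      { isPartialOrder = Flip.isPartialOrder isPartialOrder
      ; _≟_            = _≟_
      ; _≤?_           = flip (P ._⊑?_)
      }
    }
    where open IsDecPartialOrder (PosetOn.isDecPartialOrder P) using (isPartialOrder)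

  -- Reversal exchanges increasing and decreasing parts, so the two inclusions simply trade places.
  opposite-antitone : ∀ (P Q : PosetOn n) → P ≼ₚ Q → opposite Q ≼ₚ opposite P
  opposite-antitone _ _ (inc , dec) = (λ p → dec p) , (λ q → inc q)

  join : Op₂ (PosetOn n)
  join R S = opposite (meet (opposite R) (opposite S))

  ≼ₚ-isPartialOrder : IsPartialOrder (_≈ₚ_ {n}) _≼ₚ_
  ≼ₚ-isPartialOrder = record
    { isPreorder = record
      { isEquivalence = record
        { refl  = id , id
        ; sym   = swap
        ; trans = λ (f , f′) (g , g′) → (λ r → g (f r)) , (λ t → f′ (g′ t))
        }
      ; reflexive = λ (f , g) → (λ (r , a≤b) → g r , a≤b) , (λ (r , a≤b) → f r , a≤b)
      ; trans     = λ (f , f′) (g , g′) → (λ r → f (g r)) , (λ t → g′ (f′ t))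
      }
    ; antisym = λ {R} {S} R≼S S≼R → ≼ₚ⇒⊆ R S R≼S S≼R , ≼ₚ⇒⊆ S R S≼R R≼S
    }
    where
    ≼ₚ⇒⊆ : ∀ R S → R ≼ₚ S → S ≼ₚ R → R ._⊑_ ⇒ S ._⊑_
    -- Every pair is increasing or decreasing; `S ≼ₚ R` transports the former and `R ≼ₚ S` the
    -- latter.
    ≼ₚ⇒⊆ R S (_ , dec) (inc , _) {a} {b} r with ≤-total a b
    ... | inj₁ a≤b = proj₁ (inc (r , a≤b))
    ... | inj₂ b≤a = proj₁ (dec (r , b≤a))

  meet-infimum : Infimum (_≼ₚ_ {n}) meet
  meet-infimum R S = meet≼ˡ R S , meet≼ʳ R S , meet-greatest R S

  join-supremum : Supremum (_≼ₚ_ {n}) join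
  join-supremum R S =
      opposite-antitone (meet R° S°) R° (meet≼ˡ R° S°)
    , opposite-antitone (meet R° S°) S° (meet≼ʳ R° S°)
    , λ T R≼T S≼T → opposite-antitone (opposite T) (meet R° S°)
        (meet-greatest R° S° (opposite T)
          (opposite-antitone R T R≼T) (opposite-antitone S T S≼T))
    where
    R° = opposite R
    S° = opposite S

theorem1 : (n : ℕ) → ∃₂ λ (_∨_ _∧_ : Op₂ (PosetOn n)) → IsLattice _≈ₚ_ _≼ₚ_ _∨_ _∧_
theorem1 n = join , meet , record
  { isPartialOrder = ≼ₚ-isPartialOrder
  ; supremum       = join-supremum
  ; infimum        = meet-infimum
  }
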